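{- Let $a$ be an integral closed 2-frieze of width $m$ and let $b$ be an integral closed 2-frieze of width $\ell$. Let $c,d\in\mathbb{Z}$, and consider the two consecutive columns $c,c+1$ of $a$ and the two consecutive columns $d,d+1$ of $b$. Gluing the first pair of columns on top of the second pair over the pair $1\;1$ (the bottom $1\;1$ of the columns of $a$ being identified with the top $1\;1$ of the columns of $b$) leads to an integral closed 2-frieze of width $m+\ell+1$. That is, there is an integral closed 2-frieze $w$ of width $m+\ell+1$ such that, for $\epsilon\in\{0,1\}$, $$w(r,\epsilon)=a(r,c+\epsilon)\ \text{ for } 0\le r\le m+1,\qquad w(m+1+r,\epsilon)=b(r,d+\epsilon)\ \text{ for } 0\le r\le \ell+1 .$$
   Context: A closed 2-frieze of width $m\ge 0$ is an array $a(r,c)$, with rows $r\in\{0,1,\dots,m+1\}$ (numbered from top to bottom) and columns $c\in\mathbb{Z}$ (numbered from left to right), whose top and bottom rows consist of 1s, i.e. $a(0,c)=a(m+1,c)=1$ for all $c\in\mathbb{Z}$, and which satisfies the local rule $$a(r,c)=a(r,c-1)\,a(r,c+1)-a(r-1,c)\,a(r+1,c)\qquad (1\le r\le m,\ c\in\mathbb{Z}).$$ A closed 2-frieze is integral if all its entries are positive integers. -}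

module Defs where

open import Data.Nat.Base using (ℕ; _+_)
open import Data.Integer.Base as ℤ using (ℤ; 0ℤ; 1ℤ)
open import Data.Fin.Base using (Fin; zero; suc; fromℕ; inject₁)
open import Relation.Binary.PropositionalEquality.Core using (_≡_)

Array : ℕ → Set
Array m = Fin (2 + m) → ℤ → ℤ

-- In localRule, i : Fin m stands for the inner row r = toℕ i + 1, so that
-- rows r - 1, r, r + 1 are inject₁ (inject₁ i), suc (inject₁ i), suc (suc i).
record IsClosed2Frieze (m : ℕ) (a : Array m) : Set where
  field
    top       : ∀ (c : ℤ) → a zero c ≡ 1ℤ
    bottom    : ∀ (c : ℤ) → a (fromℕ (1 + m)) c ≡ 1ℤ
    localRule : ∀ (i : Fin m) (c : ℤ) →
      a (suc (inject₁ i)) c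
        ≡ a (suc (inject₁ i)) (c ℤ.- 1ℤ) ℤ.* a (suc (inject₁ i)) (c ℤ.+ 1ℤ)
          ℤ.- a (inject₁ (inject₁ i)) c ℤ.* a (suc (suc i)) c

-- Entries already lie in ℤ, so integrality adds only their positivity.
record IsIntegralClosed2Frieze (m : ℕ) (a : Array m) : Set where
  field
    isClosed2Frieze : IsClosed2Frieze m a
    positive        : ∀ (r : Fin (2 + m)) (c : ℤ) → 0ℤ ℤ.< a r c

  open IsClosed2Frieze isClosed2Frieze public

{-# OPTIONS --safe #-}
module Submission where

-- A closed 2-frieze of width m comes from a polygon of n = m + 4 vectors vᵢ in ℤ³ with
-- det(vᵢ₋₁, vᵢ, vᵢ₊₁) = 1.  Interleaving the vᵢ with the cross products vᵢ × vᵢ₊₁ gives a sequence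
-- X of period 2n such that Xₛ × Xₛ₊₂ = Xₛ₊₁ for all s, and a(r, c) = Xₛ · Xₜ with s = c - r - 1,
-- t = c + r + 2; the local rule is then the Binet-Cauchy identity.  Since the bottom entries in two
-- consecutive columns are 1, coordinates can be chosen so that the stretch of X seen by these columns
-- runs from (e₂, e₁) to (e₂, e₁).  Such loops can be concatenated, because the relation involves only
-- three consecutive vectors; concatenating the loop of a with the loop of b turned upside down gives
-- the glued columns.  All entries of the new frieze are integers, and by the local rule positivity
-- spreads from two consecutive columns to all others.

open import Data.Integer.Base as ℤ using (ℤ; +_; -[1+_]; 0ℤ; 1ℤ)
import Data.Integer.Properties as ℤ
import Data.Integer.Tactic.RingSolver as ℤ-Solver
open import Algebra.Bundles using (AbelianGroup)
open import Algebra.Properties.Group (AbelianGroup.group ℤ.+-0-abelianGroup) using (∙-cancelˡ)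
open import Data.Sum.Base using (inj₁; inj₂)
open import Relation.Binary.PropositionalEquality
open import Relation.Nullary.Decidable using (decidable-stable)
open import Relation.Nullary.Negation using (contradiction)

-- Identities for scalar and vector products in ℤ³.

module Vectors where
  open import Data.Integer.Base using (_+_; _*_; _-_)

  record Vec3 : Set where
    constructor ⟨_,_,_⟩
    field
      x y z : ℤ

  open Vec3 public

  infix 8 _·_
  infix 9 _⨯_
  infixr 7 _⊞_
  infixr 9 _✶_

  _·_ : Vec3 → Vec3 → ℤ
  u · v = x u * x v + y u * y v + z u * z v

  _⨯_ : Vec3 → Vec3 → Vec3
  u ⨯ v = ⟨ y u * z v - z u * y v
          , z u * x v - x u * z v
          , x u * y v - y u * x v ⟩

  _✶_ : ℤ → Vec3 → Vec3
  α ✶ u = ⟨ α * x u , α * y u , α * z u ⟩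

  _⊞_ : Vec3 → Vec3 → Vec3
  u ⊞ v = ⟨ x u + x v , y u + y v , z u + z v ⟩

  𝟎 e₁ e₂ e₃ : Vec3
  𝟎  = ⟨ 0ℤ , 0ℤ , 0ℤ ⟩
  e₁ = ⟨ 1ℤ , 0ℤ , 0ℤ ⟩
  e₂ = ⟨ 0ℤ , 1ℤ , 0ℤ ⟩
  e₃ = ⟨ 0ℤ , 0ℤ , 1ℤ ⟩

  Vec3-≡ : ∀ {u v} → x u ≡ x v → y u ≡ y v → z u ≡ z v → u ≡ v
  Vec3-≡ refl refl refl = refl

  ·-comm : ∀ u v → u · v ≡ v · u
  ·-comm ⟨ a , b , c ⟩ ⟨ d , e , f ⟩ =
    cong₂ _+_ (cong₂ _+_ (ℤ.*-comm a d) (ℤ.*-comm b e)) (ℤ.*-comm c f)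

  ·-e₁ : ∀ v → e₁ · v ≡ x v
  ·-e₁ ⟨ a , b , c ⟩ = lemma a b c
    where
    lemma : ∀ a b c → 1ℤ * a + 0ℤ * b + 0ℤ * c ≡ a
    lemma = ℤ-Solver.solve-∀

  ·-e₂ : ∀ v → e₂ · v ≡ y v
  ·-e₂ ⟨ a , b , c ⟩ = lemma a b c
    where
    lemma : ∀ a b c → 0ℤ * a + 1ℤ * b + 0ℤ * c ≡ b
    lemma = ℤ-Solver.solve-∀

  ·-e₃ : ∀ v → e₃ · v ≡ z v
  ·-e₃ ⟨ a , b , c ⟩ = lemma a b c
    where
    lemma : ∀ a b c → 0ℤ * a + 0ℤ * b + 1ℤ * c ≡ c
    lemma = ℤ-Solver.solve-∀

  ⨯-e₁ : ∀ t → ⟨ t , 0ℤ , 1ℤ ⟩ ⨯ e₁ ≡ e₂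
  ⨯-e₁ t = Vec3-≡ refl (lemma₂ t) (lemma₃ t)
    where
    lemma₂ : ∀ t → 1ℤ * 1ℤ - t * 0ℤ ≡ 1ℤ
    lemma₂ = ℤ-Solver.solve-∀
    lemma₃ : ∀ t → t * 0ℤ - 0ℤ * 1ℤ ≡ 0ℤ
    lemma₃ = ℤ-Solver.solve-∀

  u·u⨯v≡0 : ∀ u v → u · (u ⨯ v) ≡ 0ℤ
  u·u⨯v≡0 ⟨ a , b , c ⟩ ⟨ d , e , f ⟩ = lemma a b c d e f
    where
    lemma : ∀ a b c d e f →
      a * (b * f - c * e) + b * (c * d - a * f) + c * (a * e - b * d) ≡ 0ℤ
    lemma = ℤ-Solver.solve-∀

  binet-cauchy : ∀ u v s t →
    (u ⨯ v) · (s ⨯ t) ≡ (u · s) * (v · t) - (v · s) * (u · t)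
  binet-cauchy ⟨ a , b , c ⟩ ⟨ d , e , f ⟩ ⟨ g , h , i ⟩ ⟨ j , k , l ⟩ =
    lemma a b c d e f g h i j k l
    where
    lemma : ∀ a b c d e f g h i j k l →
      (b * f - c * e) * (h * l - i * k) + (c * d - a * f) * (i * j - g * l)
        + (a * e - b * d) * (g * k - h * j)
      ≡ (a * g + b * h + c * i) * (d * j + e * k + f * l)
        - (d * g + e * h + f * i) * (a * j + b * k + c * l)
    lemma = ℤ-Solver.solve-∀

  u⨯v·v≡0 : ∀ u v → (u ⨯ v) · v ≡ 0ℤ
  u⨯v·v≡0 ⟨ a , b , c ⟩ ⟨ d , e , f ⟩ = lemma a b c d e f
    where
    lemma : ∀ a b c d e f →
      (b * f - c * e) * d + (c * d - a * f) * e + (a * e - b * d) * f ≡ 0ℤ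
    lemma = ℤ-Solver.solve-∀

  u⨯u·v≡0 : ∀ u v → (u ⨯ u) · v ≡ 0ℤ
  u⨯u·v≡0 ⟨ a , b , c ⟩ ⟨ d , e , f ⟩ = lemma a b c d e f
    where
    lemma : ∀ a b c d e f →
      (b * c - c * b) * d + (c * a - a * c) * e + (a * b - b * a) * f ≡ 0ℤ
    lemma = ℤ-Solver.solve-∀

  -- In the triple product expansion u × (p × v) = (u · v) p - (u · p) v the second term vanishes by
  -- orthogonality.
  ⨯-⨯ : ∀ u p v → u · p ≡ 0ℤ → u ⨯ (p ⨯ v) ≡ (u · v) ✶ p
  ⨯-⨯ u@(⟨ a , b , c ⟩) p@(⟨ d , e , f ⟩) v@(⟨ g , h , i ⟩) up≡0 = Vec3-≡
    (trans (lemma₁ a b c d e f g h i) (reduce d g))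
    (trans (lemma₂ a b c d e f g h i) (reduce e h))
    (trans (lemma₃ a b c d e f g h i) (reduce f i))
    where
    reduce : ∀ s t → (u · v) * s - t * (u · p) ≡ (u · v) * s
    reduce s t = begin
      (u · v) * s - t * (u · p)  ≡⟨ cong (λ r → (u · v) * s - t * r) up≡0 ⟩
      (u · v) * s - t * 0ℤ       ≡⟨ simplify ((u · v) * s) t ⟩
      (u · v) * s                ∎
      where
      open ≡-Reasoning
      simplify : ∀ s t → s - t * 0ℤ ≡ s
      simplify = ℤ-Solver.solve-∀
    lemma₁ : ∀ a b c d e f g h i →
      b * (d * h - e * g) - c * (f * g - d * i)
      ≡ (a * g + b * h + c * i) * d - g * (a * d + b * e + c * f)
    lemma₁ = ℤ-Solver.solve-∀
    lemma₂ : ∀ a b c d e f g h i →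
      c * (e * i - f * h) - a * (d * h - e * g)
      ≡ (a * g + b * h + c * i) * e - h * (a * d + b * e + c * f)
    lemma₂ = ℤ-Solver.solve-∀
    lemma₃ : ∀ a b c d e f g h i →
      a * (f * g - d * i) - b * (e * i - f * h)
      ≡ (a * g + b * h + c * i) * f - i * (a * d + b * e + c * f)
    lemma₃ = ℤ-Solver.solve-∀

  -- The multiple of `u` is killed by `u ⨯_`, and the rest expands to (u · w) v - (u · v) w. This
  -- gives the chain relation for the vector created by `advance`.
  ⨯-step : ∀ α u v w → u · w ≡ 1ℤ → u · v ≡ 0ℤ → u ⨯ (α ✶ u ⊞ v ⨯ w) ≡ v
  ⨯-step α u@(⟨ a , b , c ⟩) v@(⟨ d , e , f ⟩) w@(⟨ g , h , i ⟩) uw≡1 uv≡0 = Vec3-≡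
    (trans (lemma₁ α a b c d e f g h i) (reduce d g))
    (trans (lemma₂ α a b c d e f g h i) (reduce e h))
    (trans (lemma₃ α a b c d e f g h i) (reduce f i))
    where
    reduce : ∀ p q → p * (u · w) - q * (u · v) ≡ p
    reduce p q = begin
      p * (u · w) - q * (u · v) ≡⟨ cong₂ (λ s t → p * s - q * t) uw≡1 uv≡0 ⟩
      p * 1ℤ - q * 0ℤ           ≡⟨ simplify p q ⟩
      p                         ∎
      where
      open ≡-Reasoning
      simplify : ∀ p q → p * 1ℤ - q * 0ℤ ≡ p
      simplify = ℤ-Solver.solve-∀
    lemma₁ : ∀ α a b c d e f g h i →
      b * (α * c + (d * h - e * g)) - c * (α * b + (f * g - d * i))
      ≡ d * (a * g + b * h + c * i) - g * (a * d + b * e + c * f)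
    lemma₁ = ℤ-Solver.solve-∀
    lemma₂ : ∀ α a b c d e f g h i →
      c * (α * a + (e * i - f * h)) - a * (α * c + (d * h - e * g))
      ≡ e * (a * g + b * h + c * i) - h * (a * d + b * e + c * f)
    lemma₂ = ℤ-Solver.solve-∀
    lemma₃ : ∀ α a b c d e f g h i →
      a * (α * b + (f * g - d * i)) - b * (α * a + (e * i - f * h))
      ≡ f * (a * g + b * h + c * i) - i * (a * d + b * e + c * f)
    lemma₃ = ℤ-Solver.solve-∀

  -- The determinant p · (v × w) is invariant under cyclic permutation; in this form it vanishes
  -- visibly for `p` equal to `v` or `w`.
  ·-step : ∀ α p u v w → p · (α ✶ u ⊞ v ⨯ w) ≡ α * (p · u) + (w ⨯ p) · v
  ·-step α ⟨ a , b , c ⟩ ⟨ d , e , f ⟩ ⟨ g , h , i ⟩ ⟨ j , k , l ⟩ =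
    lemma α a b c d e f g h i j k l
    where
    lemma : ∀ α a b c d e f g h i j k l →
      a * (α * d + (h * l - i * k)) + b * (α * e + (i * j - g * l))
        + c * (α * f + (g * k - h * j))
      ≡ α * (a * d + b * e + c * f)
        + ((k * c - l * b) * g + (l * a - j * c) * h + (j * b - k * a) * i)
    lemma = ℤ-Solver.solve-∀

  ·-stepˡ : ∀ α u v w → v · (α ✶ u ⊞ v ⨯ w) ≡ α * (v · u)
  ·-stepˡ α u v w = begin
    v · (α ✶ u ⊞ v ⨯ w)          ≡⟨ ·-step α v u v w ⟩
    α * (v · u) + (w ⨯ v) · v    ≡⟨ cong (λ t → α * (v · u) + t) (u⨯v·v≡0 w v) ⟩
    α * (v · u) + 0ℤ             ≡⟨ ℤ.+-identityʳ _ ⟩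
    α * (v · u)                  ∎
    where open ≡-Reasoning

  ·-stepʳ : ∀ α u v w → w · (α ✶ u ⊞ v ⨯ w) ≡ α * (w · u)
  ·-stepʳ α u v w = begin
    w · (α ✶ u ⊞ v ⨯ w)          ≡⟨ ·-step α w u v w ⟩
    α * (w · u) + (w ⨯ w) · v    ≡⟨ cong (λ t → α * (w · u) + t) (u⨯u·v≡0 w v) ⟩
    α * (w · u) + 0ℤ             ≡⟨ ℤ.+-identityʳ _ ⟩
    α * (w · u)                  ∎
    where open ≡-Reasoning

  -- Substituting one relation into the other gives p = u × (p × v) = (u · v) p with p nonzero.
  -- Which coordinate of p is nonzero is not known, so the proof assumes u · v ≠ 1, shows that all
  -- three vanish, and uses that equality in ℤ is decidable.
  ·≡1-between : ∀ u p q v → p ≢ 𝟎 → u ⨯ q ≡ p → p ⨯ v ≡ q → u · v ≡ 1ℤ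
  ·≡1-between u p q v p≢𝟎 uq≡p pv≡q = decidable-stable (u · v ℤ.≟ 1ℤ) λ uv≢1 →
    p≢𝟎 (Vec3-≡ (vanish uv≢1 (fixed x)) (vanish uv≢1 (fixed y)) (vanish uv≢1 (fixed z)))
    where
    open ≡-Reasoning
    u·p≡0 : u · p ≡ 0ℤ
    u·p≡0 = trans (cong (u ·_) (sym uq≡p)) (u·u⨯v≡0 u q)
    fixed : (π : Vec3 → ℤ) → π p ≡ π ((u · v) ✶ p)
    fixed π = cong π (begin
      p                                ≡⟨ uq≡p ⟨
      u ⨯ q                            ≡⟨ cong (u ⨯_) pv≡q ⟨
      u ⨯ (p ⨯ v)                      ≡⟨ ⨯-⨯ u p v u·p≡0 ⟩
      (u · v) ✶ p                      ∎)
    vanish : ∀ {t a} → t ≢ 1ℤ → a ≡ t * a → a ≡ 0ℤ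
    vanish {t} {a} t≢1 a≡ta with ℤ.i*j≡0⇒i≡0∨j≡0 (t - 1ℤ) {a} (begin
      (t - 1ℤ) * a  ≡⟨ expand t a ⟩
      t * a - a     ≡⟨ cong (λ t → t - a) a≡ta ⟨
      a - a         ≡⟨ ℤ.+-inverseʳ a ⟩
      0ℤ            ∎)
      where
      expand : ∀ t a → (t - 1ℤ) * a ≡ t * a - a
      expand = ℤ-Solver.solve-∀
    ... | inj₁ t-1≡0 = contradiction (ℤ.i-j≡0⇒i≡j t 1ℤ t-1≡0) t≢1
    ... | inj₂ a≡0   = a≡0

open Vectors
open import Defs
open import Data.Nat.Base as ℕ using (ℕ; zero; suc; _+_; _∸_; _≤_; _<_; z≤n; s≤s; z<s)
import Data.Nat.Properties as ℕ
import Data.Nat.DivMod as ℕ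
import Data.Nat.Tactic.RingSolver as ℕ-Solver
open import Data.Fin.Base using (Fin; zero; suc; toℕ; fromℕ; fromℕ<; inject₁; opposite)
open import Data.Fin.Properties
  using (toℕ-fromℕ; toℕ-fromℕ<; toℕ-inject₁; toℕ<n; opposite-prop; opposite-involutive)
open import Data.Fin.Induction using (<-weakInduction)
open import Data.Fin.Relation.Unary.Top using (view; ‵fromℕ; ‵inject₁)
open import Data.Product.Base using (Σ; _×_; _,_; proj₁; proj₂)
open import Function.Base using (_∘_)


-- Chains of vectors and the local rule for their products.

record IsChain (X : ℕ → Vec3) : Set where
  field
    cross      : ∀ s → X s ⨯ X (2 + s) ≡ X (1 + s)
    -- The zero sequence also satisfies `cross`; excluding zero vectors makes the product of vectors
    -- three apart equal to 1.
    nontrivial : ∀ s → X s ≢ 𝟎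

open IsChain

-- The entry in row r and column s + r + 1 of the header.
entry : (ℕ → Vec3) → ℕ → ℕ → ℤ
entry X s r = X s · X (3 + (s + (r + r)))

m+[1+n]+[1+n]≡2+m+n+n : ∀ m n → m + (suc n + suc n) ≡ 2 + (m + (n + n))
m+[1+n]+[1+n]≡2+m+n+n = ℕ-Solver.solve-∀

module _ {X : ℕ → Vec3} (X-chain : IsChain X) where
  ·≡1 : ∀ s → X s · X (3 + s) ≡ 1ℤ
  ·≡1 s = ·≡1-between (X s) (X (1 + s)) (X (2 + s)) (X (3 + s))
    (nontrivial X-chain (1 + s)) (cross X-chain s) (cross X-chain (1 + s))

  entry-top : ∀ s → entry X s 0 ≡ 1ℤ
  entry-top s = trans (cong (λ t → X s · X (3 + t)) (ℕ.+-identityʳ s)) (·≡1 s)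

  ·-rule : ∀ s t → X (1 + s) · X (1 + t) ≡
    (X s · X t) ℤ.* (X (2 + s) · X (2 + t)) ℤ.- (X (2 + s) · X t) ℤ.* (X s · X (2 + t))
  ·-rule s t = begin
    X (1 + s) · X (1 + t)
      ≡⟨ cong₂ _·_ (cross X-chain s) (cross X-chain t) ⟨
    (X s ⨯ X (2 + s)) · (X t ⨯ X (2 + t))
      ≡⟨ binet-cauchy (X s) (X (2 + s)) (X t) (X (2 + t)) ⟩
    (X s · X t) ℤ.* (X (2 + s) · X (2 + t)) ℤ.- (X (2 + s) · X t) ℤ.* (X s · X (2 + t)) ∎
    where open ≡-Reasoning

  -- This is the local rule in row `1 + r` and column `s + r + 3`: the indices s and 2 + s of the
  -- first factor give the neighbours on either side.
  entry-rule : ∀ s r → entry X (1 + s) (1 + r) ≡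
    entry X s (1 + r) ℤ.* entry X (2 + s) (1 + r) ℤ.- entry X (2 + s) r ℤ.* entry X s (2 + r)
  entry-rule s r = begin
    entry X (1 + s) (1 + r)
      ≡⟨ ·-rule s t ⟩
    entry X s (1 + r) ℤ.* entry X (2 + s) (1 + r) ℤ.- (X (2 + s) · X t) ℤ.* (X s · X (2 + t))
      ≡⟨ cong₂ (λ i j → entry X s (1 + r) ℤ.* entry X (2 + s) (1 + r)
                          ℤ.- (X (2 + s) · X (3 + i)) ℤ.* (X s · X (3 + j)))
           (m+[1+n]+[1+n]≡2+m+n+n s r) (sym (m+[1+n]+[1+n]≡2+m+n+n s (1 + r))) ⟩
    entry X s (1 + r) ℤ.* entry X (2 + s) (1 + r) ℤ.- entry X (2 + s) r ℤ.* entry X s (2 + r) ∎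
    where
    open ≡-Reasoning
    t : ℕ
    t = 3 + (s + ((1 + r) + (1 + r)))

-- Unfolding a chain from a prescribed row 1.

record Window : Set where
  constructor window
  field
    -- Entries of row 1 pair vectors five apart, so five consecutive vectors and one such entry
    -- determine the next vector.
    x₀ x₁ x₂ x₃ x₄ : Vec3

open Window

record IsWindow (w : Window) : Set where
  field
    cross₀ : x₀ w ⨯ x₂ w ≡ x₁ w
    cross₁ : x₁ w ⨯ x₃ w ≡ x₂ w
    cross₂ : x₂ w ⨯ x₄ w ≡ x₃ w
    unit₀  : x₀ w · x₃ w ≡ 1ℤ
    unit₁  : x₁ w · x₄ w ≡ 1ℤ
    orth   : x₃ w · x₄ w ≡ 0ℤ

-- The new vector u₅ is forced by u₃ ⨯ u₅ ≡ u₄ up to a multiple of u₃, which α = u₀ · u₅ determines.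
advance : ℤ → Window → Window
advance α (window u₀ u₁ u₂ u₃ u₄) = window u₁ u₂ u₃ u₄ (α ✶ u₃ ⊞ u₄ ⨯ u₀)

advance-isWindow : ∀ α {w} → IsWindow w → IsWindow (advance α w)
advance-isWindow α {window u₀ u₁ u₂ u₃ u₄} W = record
  { cross₀ = cross₁
  ; cross₁ = cross₂
  ; cross₂ = ⨯-step α u₃ u₄ u₀ (trans (·-comm u₃ u₀) unit₀) orth
  ; unit₀  = unit₁
  ; unit₁  = begin
      u₂ · (α ✶ u₃ ⊞ u₄ ⨯ u₀)           ≡⟨ ·-step α u₂ u₃ u₄ u₀ ⟩
      α ℤ.* (u₂ · u₃) ℤ.+ (u₀ ⨯ u₂) · u₄ ≡⟨ cong₂ (λ s v → α ℤ.* s ℤ.+ v · u₄) u₂·u₃≡0 cross₀ ⟩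
      α ℤ.* 0ℤ ℤ.+ u₁ · u₄               ≡⟨ cong₂ ℤ._+_ (ℤ.*-zeroʳ α) unit₁ ⟩
      1ℤ                                 ∎
  ; orth   = begin
      u₄ · (α ✶ u₃ ⊞ u₄ ⨯ u₀)           ≡⟨ ·-stepˡ α u₃ u₄ u₀ ⟩
      α ℤ.* (u₄ · u₃)                   ≡⟨ cong (α ℤ.*_) (trans (·-comm u₄ u₃) orth) ⟩
      α ℤ.* 0ℤ                          ≡⟨ ℤ.*-zeroʳ α ⟩
      0ℤ                                ∎
  }
  where
  open IsWindow W
  open ≡-Reasoning
  u₂·u₃≡0 : u₂ · u₃ ≡ 0ℤ
  u₂·u₃≡0 = trans (cong (u₂ ·_) (sym cross₂)) (u·u⨯v≡0 u₂ u₄)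

module Unfold (α : ℕ → ℤ) where
  windowAt : ℕ → Window
  -- The start fixes the coordinates: products with the first vectors of the chain read off the
  -- coordinates of later ones.
  windowAt zero    = window e₂ e₁ e₃ e₂ e₁
  windowAt (suc s) = advance (α s) (windowAt s)

  windowAt-isWindow : ∀ s → IsWindow (windowAt s)
  windowAt-isWindow zero    = record
    { cross₀ = refl ; cross₁ = refl ; cross₂ = refl ; unit₀ = refl ; unit₁ = refl ; orth = refl }
  windowAt-isWindow (suc s) = advance-isWindow (α s) (windowAt-isWindow s)

  unfold : ℕ → Vec3
  unfold s = x₀ (windowAt s)

  unfold-·≡1 : ∀ s → unfold s · unfold (3 + s) ≡ 1ℤ
  unfold-·≡1 s = IsWindow.unit₀ (windowAt-isWindow s)

  unfold-isChain : IsChain unfold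
  unfold-isChain = record
    { cross      = λ s → IsWindow.cross₀ (windowAt-isWindow s)
    ; nontrivial = λ s Xs≡𝟎 → contradiction
        (trans (sym (unfold-·≡1 s)) (cong (_· unfold (3 + s)) Xs≡𝟎)) λ ()
    }

  -- The cross product term is orthogonal to `unfold s`, and `α s` multiplies a product equal to 1.
  -- Hence every integer sequence is row 1 of a chain.
  unfold-entry₁ : ∀ s → entry unfold s 1 ≡ α s
  unfold-entry₁ s = begin
    unfold s · unfold (3 + (s + 2))      ≡⟨ cong (λ t → unfold s · unfold (3 + t)) (ℕ.+-comm s 2) ⟩
    unfold s · unfold (5 + s)            ≡⟨ ·-stepʳ (α s) (unfold (3 + s)) (unfold (4 + s)) (unfold s) ⟩
    α s ℤ.* (unfold s · unfold (3 + s))  ≡⟨ cong (α s ℤ.*_) (unfold-·≡1 s) ⟩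
    α s ℤ.* 1ℤ                           ≡⟨ ℤ.*-identityʳ (α s) ⟩
    α s                                  ∎
    where open ≡-Reasoning

-- From a frieze to a loop of vectors.

record IsHalfFrieze (m : ℕ) (h : Fin (2 + m) → ℕ → ℤ) : Set where
  field
    top     : ∀ n → h zero n ≡ 1ℤ
    bottom  : ∀ n → h (fromℕ (1 + m)) n ≡ 1ℤ
    rule    : ∀ (i : Fin m) n →
      h (suc (inject₁ i)) (1 + n)
        ≡ h (suc (inject₁ i)) n ℤ.* h (suc (inject₁ i)) (2 + n)
          ℤ.- h (inject₁ (inject₁ i)) (1 + n) ℤ.* h (suc (suc i)) (1 + n)
    nonzero : ∀ r n → h r n ≢ 0ℤ

-- Used to solve the local rule for the entry below, `q` being the entry above.
p-q*i≡p-q*j⇒i≡j : ∀ p q {i j} → q ≢ 0ℤ → p ℤ.- q ℤ.* i ≡ p ℤ.- q ℤ.* j → i ≡ j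
p-q*i≡p-q*j⇒i≡j p q {i} {j} q≢0 eq =
  ℤ.*-cancelˡ-≡ q i j {{ℤ.≢-nonZero q≢0}} (ℤ.neg-injective (∙-cancelˡ p _ _ eq))

record Loop (T : ℕ) : Set where
  field
    path    : ℕ → Vec3
    isChain : IsChain path
    start₀  : path 0 ≡ e₂
    start₁  : path 1 ≡ e₁
    end₀    : path T ≡ e₂
    end₁    : path (1 + T) ≡ e₁

-- The full period has 2m + 8 steps; a loop leaves out the three steps e₂, e₁, e₃, e₂.
loopLength : ℕ → ℕ
loopLength m = 3 + ((1 + m) + (1 + m))

module FromHalfFrieze {m h} (H : IsHalfFrieze m h) where
  open IsHalfFrieze H
  open Unfold (λ s → h (suc zero) (s + 1))
  open ≡-Reasoning

  P : ℕ → Vec3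
  P = unfold

  P-chain : IsChain P
  P-chain = unfold-isChain

  Agree : Fin (2 + m) → ℕ → Set
  Agree r k = ∀ s → entry P s k ≡ h r (s + k)

  -- The local rule is a recursion of order two in the rows, so the induction carries two adjacent
  -- rows. Chain and half frieze obey the same rule, and dividing by the nonzero entry two rows
  -- above determines the new row.
  adjacent-rows-agree : ∀ (i : Fin (1 + m)) → Agree (inject₁ i) (toℕ i) × Agree (suc i) (1 + toℕ i)
  adjacent-rows-agree = <-weakInduction _
    ((λ s → trans (entry-top P-chain s) (sym (top _))) , unfold-entry₁) next
    where
    next : ∀ (j : Fin m) →
      Agree (inject₁ (inject₁ j)) (toℕ (inject₁ j)) × Agree (suc (inject₁ j)) (1 + toℕ (inject₁ j)) →
      Agree (suc (inject₁ j)) (1 + toℕ j) × Agree (suc (suc j)) (2 + toℕ j)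
    next j rewrite toℕ-inject₁ j = λ (row₀ , row₁) → row₁ , λ s →
      let k = toℕ j
          n = s + (1 + k)
          1+n≡s+2+k : 1 + n ≡ s + (2 + k)
          1+n≡s+2+k = sym (ℕ.+-suc s (1 + k))
          h₀ = h (inject₁ (inject₁ j)); h₁ = h (suc (inject₁ j)); h₂ = h (suc (suc j))
          row₀′ : entry P (2 + s) k ≡ h₀ (1 + n)
          row₀′ = trans (row₀ (2 + s)) (cong (λ t → h₀ (1 + t)) (sym (ℕ.+-suc s k)))
      in trans
        (p-q*i≡p-q*j⇒i≡j (h₁ n ℤ.* h₁ (2 + n)) (h₀ (1 + n)) (nonzero _ (1 + n)) (begin
          h₁ n ℤ.* h₁ (2 + n) ℤ.- h₀ (1 + n) ℤ.* entry P s (2 + k)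
            ≡⟨ cong₂ ℤ._-_ (cong₂ ℤ._*_ (row₁ s) (row₁ (2 + s)))
                           (cong (ℤ._* entry P s (2 + k)) row₀′) ⟨
          entry P s (1 + k) ℤ.* entry P (2 + s) (1 + k) ℤ.- entry P (2 + s) k ℤ.* entry P s (2 + k)
            ≡⟨ entry-rule P-chain s k ⟨
          entry P (1 + s) (1 + k)
            ≡⟨ row₁ (1 + s) ⟩
          h₁ (1 + n)
            ≡⟨ rule j n ⟩
          h₁ n ℤ.* h₁ (2 + n) ℤ.- h₀ (1 + n) ℤ.* h₂ (1 + n) ∎))
        (cong h₂ 1+n≡s+2+k)

  entry-agrees : ∀ r → Agree r (toℕ r)
  entry-agrees zero    = proj₁ (adjacent-rows-agree zero)
  entry-agrees (suc i) = proj₂ (adjacent-rows-agree i)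

  entry≢0 : ∀ s → entry P s m ≢ 0ℤ
  entry≢0 s eq = nonzero (inject₁ (fromℕ m)) _ (begin
    h (inject₁ (fromℕ m)) (s + toℕ (fromℕ m)) ≡⟨ proj₁ (adjacent-rows-agree (fromℕ m)) s ⟨
    entry P s (toℕ (fromℕ m))                ≡⟨ cong (entry P s) (toℕ-fromℕ m) ⟩
    entry P s m                              ≡⟨ eq ⟩
    0ℤ                                       ∎)

  entry-bottom : ∀ s → entry P s (1 + m) ≡ 1ℤ
  entry-bottom s = begin
    entry P s (1 + m)                  ≡⟨ cong (entry P s) (toℕ-fromℕ (1 + m)) ⟨
    entry P s (toℕ (fromℕ (1 + m)))    ≡⟨ entry-agrees (fromℕ (1 + m)) s ⟩
    h (fromℕ (1 + m)) _                ≡⟨ bottom _ ⟩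
    1ℤ                                 ∎

  -- In the bottom row of 1s the rule reads 1 = 1 · 1 - q i, where q is a nonzero entry of row `m`
  -- and i the entry sought.
  entry-below₁ : ∀ s → entry P s (2 + m) ≡ 0ℤ
  entry-below₁ s = p-q*i≡p-q*j⇒i≡j 1ℤ (entry P (2 + s) m) (entry≢0 (2 + s)) (begin
    1ℤ ℤ.- entry P (2 + s) m ℤ.* entry P s (2 + m)
      ≡⟨ cong (λ t → t ℤ.- entry P (2 + s) m ℤ.* entry P s (2 + m))
           (cong₂ ℤ._*_ (entry-bottom s) (entry-bottom (2 + s))) ⟨
    entry P s (1 + m) ℤ.* entry P (2 + s) (1 + m) ℤ.- entry P (2 + s) m ℤ.* entry P s (2 + m)
      ≡⟨ entry-rule P-chain s m ⟨
    entry P (1 + s) (1 + m)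
      ≡⟨ entry-bottom (1 + s) ⟩
    1ℤ
      ≡⟨ cong (λ t → 1ℤ ℤ.- t) (ℤ.*-zeroʳ (entry P (2 + s) m)) ⟨
    1ℤ ℤ.- entry P (2 + s) m ℤ.* 0ℤ ∎)

  -- One row further down the rule reads 0 = 0 · 0 - 1 · i.
  entry-below₂ : ∀ s → entry P s (3 + m) ≡ 0ℤ
  entry-below₂ s = p-q*i≡p-q*j⇒i≡j 0ℤ 1ℤ (λ ()) (begin
    0ℤ ℤ.- 1ℤ ℤ.* entry P s (3 + m)
      ≡⟨ cong₂ (λ t u → t ℤ.- u ℤ.* entry P s (3 + m))
           (cong₂ ℤ._*_ (entry-below₁ s) (entry-below₁ (2 + s))) (entry-bottom (2 + s)) ⟨
    entry P s (2 + m) ℤ.* entry P (2 + s) (2 + m) ℤ.- entry P (2 + s) (1 + m) ℤ.* entry P s (3 + m)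
      ≡⟨ entry-rule P-chain s (1 + m) ⟨
    entry P (1 + s) (2 + m)
      ≡⟨ entry-below₁ (1 + s) ⟩
    0ℤ ∎)

  T : ℕ
  T = loopLength m

  [2+m]+[2+m]≡ : (2 + m) + (2 + m) ≡ 2 + ((1 + m) + (1 + m))
  [2+m]+[2+m]≡ = m+[1+n]+[1+n]≡2+m+n+n 0 (1 + m)

  [3+m]+[3+m]≡ : (3 + m) + (3 + m) ≡ 4 + ((1 + m) + (1 + m))
  [3+m]+[3+m]≡ = trans (m+[1+n]+[1+n]≡2+m+n+n 0 (2 + m)) (cong (λ t → 2 + t) [2+m]+[2+m]≡)

  -- The coordinates are products with `P 4`, `P 0` and `P 2`, which are e₁, e₂ and e₃. These
  -- products are entries of the bottom row, of the second row below it and of the first row below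
  -- it.
  P[4+T]≡e₁ : P (4 + T) ≡ e₁
  P[4+T]≡e₁ = Vec3-≡
    (trans (sym (·-e₁ (P (4 + T)))) (entry-bottom 4))
    (trans (sym (·-e₂ (P (4 + T))))
      (trans (cong (λ t → P 0 · P (3 + t)) (sym [3+m]+[3+m]≡)) (entry-below₂ 0)))
    (trans (sym (·-e₃ (P (4 + T))))
      (trans (cong (λ t → P 2 · P (5 + t)) (sym [2+m]+[2+m]≡)) (entry-below₁ 2)))

  -- x (P (2 + T)) is left undetermined here, but it does not contribute to the product with e₁.
  P[2+T]≡ : P (2 + T) ≡ ⟨ x (P (2 + T)) , 0ℤ , 1ℤ ⟩
  P[2+T]≡ = Vec3-≡ refl
    (trans (sym (·-e₂ (P (2 + T))))
      (trans (cong (λ t → P 0 · P (3 + t)) (sym [2+m]+[2+m]≡)) (entry-below₁ 0)))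
    (trans (sym (·-e₃ (P (2 + T)))) (entry-bottom 2))

  P[3+T]≡e₂ : P (3 + T) ≡ e₂
  P[3+T]≡e₂ = begin
    P (3 + T)                              ≡⟨ cross P-chain (2 + T) ⟨
    P (2 + T) ⨯ P (4 + T)                  ≡⟨ cong₂ _⨯_ P[2+T]≡ P[4+T]≡e₁ ⟩
    ⟨ x (P (2 + T)) , 0ℤ , 1ℤ ⟩ ⨯ e₁        ≡⟨ ⨯-e₁ (x (P (2 + T))) ⟩
    e₂                                     ∎

  loop : Loop T
  loop = record
    -- The shift by 3 skips e₂, e₁, e₃, so the loop starts at the second pair e₂, e₁ of the initial
    -- window.
    { path    = λ s → P (3 + s)
    ; isChain = record
        { cross      = λ s → cross P-chain (3 + s)
        ; nontrivial = λ s → nontrivial P-chain (3 + s)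
        }
    ; start₀  = refl
    ; start₁  = refl
    ; end₀    = P[3+T]≡e₂
    ; end₁    = P[4+T]≡e₁
    }

  loop-entry : ∀ r s → entry (Loop.path loop) s (toℕ r) ≡ h r (3 + (s + toℕ r))
  loop-entry r s = entry-agrees r (3 + s)

-- Entries with `s + toℕ r` constant form a column. For `T` equal to `loopLength m` and ε ≤ 1, the
-- vectors paired have indices from 0 to `1 + T`, so the stretch between the two end pairs
-- determines both columns.
FollowsColumns : ∀ {m T} → Loop T → Array m → ℤ → Set
FollowsColumns {m} L a c = ∀ r s ε → s + toℕ r ≡ (1 + m) + ε →
  entry (Loop.path L) s (toℕ r) ≡ a r (c ℤ.+ + ε)

columnsFrom : ∀ {m} → Array m → ℤ → Fin (2 + m) → ℕ → ℤ
columnsFrom a c r n = a r (c ℤ.+ + n)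

columnsFrom-isHalfFrieze : ∀ {m} {a : Array m} → IsIntegralClosed2Frieze m a → ∀ c →
  IsHalfFrieze m (columnsFrom a c)
columnsFrom-isHalfFrieze {m} {a} F c = record
  { top     = λ n → top _
  ; bottom  = λ n → bottom _
  ; rule    = λ i n → subst₂
      (λ p q → a (suc (inject₁ i)) (c ℤ.+ + (1 + n))
        ≡ a (suc (inject₁ i)) p ℤ.* a (suc (inject₁ i)) q
          ℤ.- a (inject₁ (inject₁ i)) (c ℤ.+ + (1 + n)) ℤ.* a (suc (suc i)) (c ℤ.+ + (1 + n)))
      (left c (+ n)) (right c (+ n)) (localRule i (c ℤ.+ + (1 + n)))
  ; nonzero = λ r n a≡0 → ℤ.<-irrefl (sym a≡0) (positive r _)
  }
  where
  open IsIntegralClosed2Frieze F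
  left : ∀ c k → c ℤ.+ (1ℤ ℤ.+ k) ℤ.- 1ℤ ≡ c ℤ.+ k
  left = ℤ-Solver.solve-∀
  right : ∀ c k → c ℤ.+ (1ℤ ℤ.+ k) ℤ.+ 1ℤ ≡ c ℤ.+ (+ 2 ℤ.+ k)
  right = ℤ-Solver.solve-∀

frieze⇒loop : ∀ {m} {a : Array m} → IsIntegralClosed2Frieze m a → ∀ c →
  Σ (Loop (loopLength m)) λ L → FollowsColumns L a c
frieze⇒loop {m} {a} F c = loop , λ r s ε s+r≡ → begin
  entry (Loop.path loop) s (toℕ r)        ≡⟨ loop-entry r s ⟩
  a r (c₀ ℤ.+ + (3 + (s + toℕ r)))         ≡⟨ cong (λ t → a r (c₀ ℤ.+ + (3 + t))) s+r≡ ⟩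
  a r (c₀ ℤ.+ (+ (4 + m) ℤ.+ + ε))         ≡⟨ cong (a r) (cancel c (+ (4 + m)) (+ ε)) ⟩
  a r (c ℤ.+ + ε)                          ∎
  where
  open ≡-Reasoning
  -- By `loop-entry` the columns of the loop are those at 3 + (1 + m) + ε in the half frieze; this
  -- origin places them at c + ε.
  c₀ : ℤ
  c₀ = c ℤ.- + (4 + m)
  cancel : ∀ c k e → c ℤ.- k ℤ.+ (k ℤ.+ e) ≡ c ℤ.+ e
  cancel = ℤ-Solver.solve-∀
  open FromHalfFrieze (columnsFrom-isHalfFrieze F c₀)

-- Turning a frieze upside down.

opposite-inject₁ : ∀ {n} (i : Fin n) → opposite (inject₁ i) ≡ suc (opposite i)
opposite-inject₁ zero    = refl
opposite-inject₁ (suc i) = cong inject₁ (opposite-inject₁ i)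

-- The local rule is symmetric in the entries above and below.
flip-integral : ∀ {m} {a : Array m} → IsIntegralClosed2Frieze m a →
  IsIntegralClosed2Frieze m (λ r → a (opposite r))
flip-integral {m} {a} F = record
  { isClosed2Frieze = record
    { top       = bottom
    ; bottom    = λ c → trans (cong (λ r → a r c) (opposite-involutive zero)) (top c)
    ; localRule = rule
    }
  ; positive = λ r → positive (opposite r)
  }
  where
  open IsIntegralClosed2Frieze F
  rule : ∀ (i : Fin m) c → a (opposite (suc (inject₁ i))) c
    ≡ a (opposite (suc (inject₁ i))) (c ℤ.- 1ℤ) ℤ.* a (opposite (suc (inject₁ i))) (c ℤ.+ 1ℤ)
      ℤ.- a (opposite (inject₁ (inject₁ i))) c ℤ.* a (opposite (suc (suc i))) c
  rule i c rewrite opposite-inject₁ (inject₁ i) | opposite-inject₁ i =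
    trans (localRule (opposite i) c)
      (cong (λ t → a (suc (inject₁ (opposite i))) (c ℤ.- 1ℤ)
                     ℤ.* a (suc (inject₁ (opposite i))) (c ℤ.+ 1ℤ) ℤ.- t)
        (ℤ.*-comm (a (inject₁ (inject₁ (opposite i))) c) (a (suc (suc (opposite i))) c)))

-- Concatenation of loops.

glue : ℕ → (ℕ → Vec3) → (ℕ → Vec3) → ℕ → Vec3
glue zero    A B k       = B k
glue (suc n) A B zero    = A zero
glue (suc n) A B (suc k) = glue n (A ∘ suc) B k

glue-right : ∀ n A B k → glue n A B (n + k) ≡ B k
glue-right zero    A B k = refl
glue-right (suc n) A B k = glue-right n (A ∘ suc) B k

glue-left : ∀ n A B → A n ≡ B 0 → A (1 + n) ≡ B 1 → ∀ {k} → k ≤ 1 + n → glue n A B k ≡ A k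
glue-left zero    A B A₀ A₁ z≤n       = sym A₀
glue-left zero    A B A₀ A₁ (s≤s z≤n) = sym A₁
glue-left (suc n) A B A₀ A₁ z≤n       = refl
glue-left (suc n) A B A₀ A₁ (s≤s k≤)  = glue-left n (A ∘ suc) B A₀ A₁ k≤

tail-isChain : ∀ {X} → IsChain X → IsChain (X ∘ suc)
tail-isChain C = record { cross = cross C ∘ suc ; nontrivial = nontrivial C ∘ suc }

-- As two vectors overlap, any three consecutive vectors lie entirely in `A` or entirely in `B`.
glue-isChain : ∀ n {A B} → IsChain A → IsChain B → A n ≡ B 0 → A (1 + n) ≡ B 1 →
  IsChain (glue n A B)
glue-isChain zero            CA CB A₀ A₁ = record { cross = cross CB ; nontrivial = nontrivial CB }
glue-isChain (suc n) {A} {B} CA CB A₀ A₁ = record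
  { cross      = λ { zero    → cross₀
                   ; (suc s) → cross rest s }
  ; nontrivial = λ { zero    → nontrivial CA zero
                   ; (suc s) → nontrivial rest s }
  }
  where
  open ≡-Reasoning
  rest : IsChain (glue n (A ∘ suc) B)
  rest = glue-isChain n (tail-isChain CA) CB A₀ A₁
  left : ∀ {k} → k ≤ 1 + n → glue n (A ∘ suc) B k ≡ A (suc k)
  left = glue-left n (A ∘ suc) B A₀ A₁
  cross₀ : A 0 ⨯ glue n (A ∘ suc) B 1 ≡ glue n (A ∘ suc) B 0
  cross₀ = begin
    A 0 ⨯ glue n (A ∘ suc) B 1 ≡⟨ cong (A 0 ⨯_) (left (s≤s z≤n)) ⟩
    A 0 ⨯ A 2                  ≡⟨ cross CA 0 ⟩
    A 1                        ≡⟨ left z≤n ⟨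
    glue n (A ∘ suc) B 0       ∎

module _ {T T′} (A : Loop T) (B : Loop T′) where
  private
    module A = Loop A
    module B = Loop B

    A₀ : A.path T ≡ B.path 0
    A₀ = trans A.end₀ (sym B.start₀)

    A₁ : A.path (1 + T) ≡ B.path 1
    A₁ = trans A.end₁ (sym B.start₁)

  concat-left : ∀ {k} → k ≤ 1 + T → glue T A.path B.path k ≡ A.path k
  concat-left = glue-left T A.path B.path A₀ A₁

  concat-right : ∀ k → glue T A.path B.path (T + k) ≡ B.path k
  concat-right = glue-right T A.path B.path

  concat : Loop (T + T′)
  concat = record
    { path    = glue T A.path B.path
    ; isChain = glue-isChain T A.isChain B.isChain A₀ A₁
    ; start₀  = trans (concat-left z≤n) A.start₀
    ; start₁  = trans (concat-left (s≤s z≤n)) A.start₁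
    ; end₀    = trans (concat-right T′) B.end₀
    ; end₁    = trans (cong (glue T A.path B.path) (sym (ℕ.+-suc T T′)))
                      (trans (concat-right (1 + T′)) B.end₁)
    }

-- Periodic extension of a loop to integer indices.

module Periodic {n} (L : Loop (2 + n)) where
  open Loop L
  open ≡-Reasoning

  private
    K : ℕ
    K = 2 + n

  cycle : ℕ → Vec3
  cycle k = path (k ℕ.% K)

  -- The indices `K` and `1 + K` wrap around to 0 and 1, where the path has the same vectors because
  -- it is a loop. As K ≥ 2, the residue of 1 is 1.
  cycle-path : ∀ {j} → j ≤ 1 + K → cycle j ≡ path j
  cycle-path {j} j≤1+K with ℕ.m≤n⇒m<n∨m≡n j≤1+K
  ... | inj₂ refl = begin
    cycle (1 + K)        ≡⟨ cong path (ℕ.[m+n]%n≡m%n 1 K) ⟩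
    path 1               ≡⟨ trans start₁ (sym end₁) ⟩
    path (1 + K)         ∎
  ... | inj₁ (s≤s j≤K) with ℕ.m≤n⇒m<n∨m≡n j≤K
  ...   | inj₁ j<K  = cong path (ℕ.m<n⇒m%n≡m j<K)
  ...   | inj₂ refl = begin
    cycle K        ≡⟨ cong path (ℕ.n%n≡0 K) ⟩
    path 0         ≡⟨ trans start₀ (sym end₀) ⟩
    path K         ∎

  cycle-period : ∀ k → cycle (k + K) ≡ cycle k
  cycle-period k = cong path (ℕ.[m+n]%n≡m%n k K)

  -- Three consecutive vectors starting at a residue, at most K - 1, end no later than index
  -- `1 + K`, so relations between them can be taken from the path.
  cycle-+ : ∀ t k → t ≤ 2 → cycle (t + k) ≡ path (t + k ℕ.% K)
  cycle-+ t k t≤2 = begin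
    path ((t + k) ℕ.% K)                      ≡⟨ cong path (ℕ.%-distribˡ-+ t k K) ⟩
    path ((t ℕ.% K + k ℕ.% K) ℕ.% K)          ≡⟨ cong (λ j → path ((t ℕ.% K + j) ℕ.% K)) (ℕ.m%n%n≡m%n k K) ⟨
    path ((t ℕ.% K + k ℕ.% K ℕ.% K) ℕ.% K)    ≡⟨ cong path (ℕ.%-distribˡ-+ t (k ℕ.% K) K) ⟨
    path ((t + k ℕ.% K) ℕ.% K)                ≡⟨ cycle-path (ℕ.+-mono-≤ t≤2 (ℕ.≤-pred (ℕ.m%n<n k K))) ⟩
    path (t + k ℕ.% K)                        ∎

  cycle-isChain : IsChain cycle
  cycle-isChain = record
    { cross      = λ k → begin
        cycle k ⨯ cycle (2 + k)                   ≡⟨ cong (cycle k ⨯_) (cycle-+ 2 k ℕ.≤-refl) ⟩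
        path (k ℕ.% K) ⨯ path (2 + k ℕ.% K)       ≡⟨ cross isChain (k ℕ.% K) ⟩
        path (1 + k ℕ.% K)                        ≡⟨ cycle-+ 1 k (s≤s z≤n) ⟨
        cycle (1 + k)                             ∎
    ; nontrivial = λ k → nontrivial isChain (k ℕ.% K)
    }

  -- Since K - 1 ≡ -1 modulo K, residue i ≡ i.
  residue : ℤ → ℕ
  residue (+ k)    = k
  residue -[1+ k ] = suc k ℕ.* (1 + n)

  -- The chain indexed by ℤ is given by its tails, one for each starting index, so that results on
  -- chains over ℕ apply.
  unroll : ℤ → ℕ → Vec3
  unroll i t = cycle (t + residue i)

  unroll-isChain : ∀ i → IsChain (unroll i)
  unroll-isChain i = record
    { cross      = λ s → cross cycle-isChain (s + residue i)
    ; nontrivial = λ s → nontrivial cycle-isChain (s + residue i)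
    }

  unroll-period : ∀ i t → unroll i (t + K) ≡ unroll i t
  unroll-period i t = trans (cong cycle (rearrange t K (residue i))) (cycle-period (t + residue i))
    where
    rearrange : ∀ t k f → t + k + f ≡ t + f + k
    rearrange = ℕ-Solver.solve-∀

  -- For negative `i`, `residue (ℤ.suc i) + K` equals `1 + residue i`, and the period absorbs K.
  unroll-suc : ∀ i t → unroll (ℤ.suc i) t ≡ unroll i (suc t)
  unroll-suc (+ k)          t = cong cycle (ℕ.+-suc t k)
  unroll-suc -[1+ zero ]    t = begin
    cycle (t + 0)            ≡⟨ cycle-period (t + 0) ⟨
    cycle (t + 0 + K)        ≡⟨ cong cycle (rearrange t n) ⟩
    cycle (suc t + (1 + n + 0)) ∎
    where
    rearrange : ∀ t n → t + 0 + (2 + n) ≡ suc t + (1 + n + 0)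
    rearrange = ℕ-Solver.solve-∀
  unroll-suc -[1+ suc k ]   t = begin
    cycle (t + f)               ≡⟨ cycle-period (t + f) ⟨
    cycle (t + f + K)           ≡⟨ cong cycle (rearrange t n f) ⟩
    cycle (suc t + (1 + n + f)) ∎
    where
    f : ℕ
    f = suc k ℕ.* (1 + n)
    rearrange : ∀ t n f → t + f + (2 + n) ≡ suc t + (1 + n + f)
    rearrange = ℕ-Solver.solve-∀

  unroll-+ : ∀ k i t → unroll (+ k ℤ.+ i) t ≡ unroll i (k + t)
  unroll-+ zero    i t = cong (λ j → unroll j t) (ℤ.+-identityˡ i)
  unroll-+ (suc k) i t = begin
    unroll (+ suc k ℤ.+ i) t        ≡⟨ cong (λ j → unroll j t) (ℤ.+-assoc 1ℤ (+ k) i) ⟩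
    unroll (ℤ.suc (+ k ℤ.+ i)) t    ≡⟨ unroll-suc (+ k ℤ.+ i) t ⟩
    unroll (+ k ℤ.+ i) (suc t)      ≡⟨ unroll-+ k i (suc t) ⟩
    unroll i (k + suc t)            ≡⟨ cong (unroll i) (ℕ.+-suc k t) ⟩
    unroll i (suc k + t)            ∎

  entry-unroll-+ : ∀ k i r → entry (unroll (+ k ℤ.+ i)) 0 r ≡ entry (unroll i) k r
  entry-unroll-+ k i r = cong₂ _·_
    (trans (unroll-+ k i 0) (cong (unroll i) (ℕ.+-identityʳ k)))
    (trans (unroll-+ k i _) (cong (unroll i) (rearrange k (r + r))))
    where
    rearrange : ∀ k q → k + (3 + (0 + q)) ≡ 3 + (k + q)
    rearrange = ℕ-Solver.solve-∀

-- Positivity spreads from two consecutive columns.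

PositiveColumn : ∀ {m} → Array m → ℤ → Set
PositiveColumn a c = ∀ r → 0ℤ ℤ.< a r c

-- The product p q = i + j k is positive, and so is p. Applied to the local rule, this passes from
-- one outer column to the other across a positive middle column.
positive-factor : ∀ {i p q j k} → i ≡ p ℤ.* q ℤ.- j ℤ.* k →
  0ℤ ℤ.< i → 0ℤ ℤ.< j → 0ℤ ℤ.< k → 0ℤ ℤ.< p → 0ℤ ℤ.< q
positive-factor {i} {p} {q} {j} {k} i≡pq-jk 0<i 0<j 0<k 0<p =
  ℤ.*-cancelˡ-<-nonNeg p {{ℤ.nonNegative (ℤ.<⇒≤ 0<p)}} (begin-strict
    p ℤ.* 0ℤ                           ≡⟨ ℤ.*-zeroʳ p ⟩
    0ℤ                                 <⟨ ℤ.+-mono-< 0<i 0<jk ⟩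
    i ℤ.+ j ℤ.* k                      ≡⟨ cong (ℤ._+ j ℤ.* k) i≡pq-jk ⟩
    p ℤ.* q ℤ.- j ℤ.* k ℤ.+ j ℤ.* k    ≡⟨ cancel (p ℤ.* q) (j ℤ.* k) ⟩
    p ℤ.* q                            ∎)
  where
  open ℤ.≤-Reasoning
  cancel : ∀ s t → s ℤ.- t ℤ.+ t ≡ s
  cancel = ℤ-Solver.solve-∀
  0<jk : 0ℤ ℤ.< j ℤ.* k
  0<jk = begin-strict
    0ℤ         ≡⟨ ℤ.*-zeroʳ j ⟨
    j ℤ.* 0ℤ   <⟨ ℤ.*-monoˡ-<-pos j {{ℤ.positive 0<j}} 0<k ⟩
    j ℤ.* k    ∎

module _ {m} {a : Array m} (F : IsClosed2Frieze m a) where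
  open IsClosed2Frieze F

  PositiveAt : ℤ → Set
  PositiveAt c = PositiveColumn a c × PositiveColumn a (ℤ.suc c)

  outer-rows : ∀ c → (∀ i → 0ℤ ℤ.< a (suc (inject₁ i)) c) → PositiveColumn a c
  outer-rows c inner zero    = subst (0ℤ ℤ.<_) (sym (top c)) (ℤ.+<+ z<s)
  outer-rows c inner (suc j) with view j
  ... | ‵fromℕ     = subst (0ℤ ℤ.<_) (sym (bottom c)) (ℤ.+<+ z<s)
  ... | ‵inject₁ i = inner i

  localRule-suc : ∀ i c → a (suc (inject₁ i)) (ℤ.suc c)
    ≡ a (suc (inject₁ i)) c ℤ.* a (suc (inject₁ i)) (ℤ.suc (ℤ.suc c))
      ℤ.- a (inject₁ (inject₁ i)) (ℤ.suc c) ℤ.* a (suc (suc i)) (ℤ.suc c)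
  localRule-suc i c = subst₂
    (λ p q → a (suc (inject₁ i)) (ℤ.suc c)
      ≡ a (suc (inject₁ i)) p ℤ.* a (suc (inject₁ i)) q
        ℤ.- a (inject₁ (inject₁ i)) (ℤ.suc c) ℤ.* a (suc (suc i)) (ℤ.suc c))
    (left c) (ℤ.+-comm (ℤ.suc c) 1ℤ) (localRule i (ℤ.suc c))
    where
    left : ∀ c → 1ℤ ℤ.+ c ℤ.- 1ℤ ≡ c
    left = ℤ-Solver.solve-∀

  positiveAt-suc : ∀ c → PositiveAt c → PositiveAt (ℤ.suc c)
  positiveAt-suc c (p₀ , p₁) = p₁ , outer-rows _ λ i →
    positive-factor (localRule-suc i c) (p₁ _) (p₁ _) (p₁ _) (p₀ _)

  positiveAt-pred : ∀ c → PositiveAt (ℤ.suc c) → PositiveAt c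
  positiveAt-pred c (p₁ , p₂) = outer-rows _ (λ i →
    let r = suc (inject₁ i) in
    positive-factor
      (trans (localRule-suc i c)
        (cong (ℤ._- a (inject₁ (inject₁ i)) (ℤ.suc c) ℤ.* a (suc (suc i)) (ℤ.suc c))
          (ℤ.*-comm (a r c) (a r (ℤ.suc (ℤ.suc c))))))
      (p₁ _) (p₁ _) (p₁ _) (p₂ _)) , p₁

  positive-from-two-columns : PositiveAt 0ℤ → ∀ c → PositiveColumn a c
  positive-from-two-columns p₀ c = proj₁ (everywhere c)
    where
    everywhere : ∀ c → PositiveAt c
    everywhere (+ zero)       = p₀
    everywhere (+ suc n)      = positiveAt-suc (+ n) (everywhere (+ n))
    everywhere -[1+ zero ]    = positiveAt-pred -[1+ 0 ] p₀
    everywhere -[1+ suc n ]   = positiveAt-pred -[1+ suc n ] (everywhere -[1+ n ])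

-- The glued frieze.

entry-within-loop : ∀ {m k s ε} → k ≤ 1 + m → ε ≤ 1 → s + k ≡ (1 + m) + ε →
  3 + (s + (k + k)) ≤ 1 + loopLength m
entry-within-loop {m} {k} {s} {ε} k≤1+m ε≤1 s+k≡ = begin
  3 + (s + (k + k))                  ≡⟨ cong (λ t → 3 + t) (ℕ.+-assoc s k k) ⟨
  3 + ((s + k) + k)                  ≡⟨ cong (λ t → 3 + (t + k)) s+k≡ ⟩
  -- Equality holds in the bottom row with ε = 1: the second column reaches exactly the last vector
  -- of the end pair.
  3 + (((1 + m) + ε) + k)            ≤⟨ ℕ.+-monoʳ-≤ 3 (ℕ.+-mono-≤ (ℕ.+-monoʳ-≤ (1 + m) ε≤1) k≤1+m) ⟩
  3 + (((1 + m) + 1) + (1 + m))      ≡⟨ rearrange m ⟩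
  1 + loopLength m                       ∎
  where
  open ℕ.≤-Reasoning
  rearrange : ∀ m → 3 + (((1 + m) + 1) + (1 + m)) ≡ 4 + ((1 + m) + (1 + m))
  rearrange = ℕ-Solver.solve-∀

module Glued {m ℓ} {a : Array m} {b : Array ℓ} {c d}
  (A : Loop (loopLength m)) (A-columns : FollowsColumns A a c)
  (B : Loop (loopLength ℓ)) (B-columns : FollowsColumns B (λ r → b (opposite r)) d) where

  open Periodic (concat A B)
  open ≡-Reasoning

  N : ℕ
  N = m + ℓ + 1

  K : ℕ
  K = loopLength m + loopLength ℓ

  -- Normalised so that base 0 (1 + m) = 0: the concatenated path starts at the glued row.
  base : ℤ → ℕ → ℤ
  base c r = c ℤ.+ + (1 + m) ℤ.- + r

  row : ℕ → ℤ → ℤ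
  row r c = entry (unroll (base c r)) 0 r

  w : Array N
  w r = row (toℕ r)

  row-rule : ∀ r c → row (1 + r) c
    ≡ row (1 + r) (c ℤ.- 1ℤ) ℤ.* row (1 + r) (c ℤ.+ 1ℤ) ℤ.- row r c ℤ.* row (2 + r) c
  row-rule r c = begin
    row (1 + r) c
      ≡⟨ shifted 1 (1 + r) (centre c (+ (1 + m)) (+ r)) ⟩
    entry U 1 (1 + r)
      ≡⟨ entry-rule (unroll-isChain σ) 0 r ⟩
    entry U 0 (1 + r) ℤ.* entry U 2 (1 + r) ℤ.- entry U 2 r ℤ.* entry U 0 (2 + r)
      ≡⟨ cong₂ ℤ._-_
           (cong₂ ℤ._*_ (shifted 0 (1 + r) (left c (+ (1 + m)) (+ r)))
                        (shifted 2 (1 + r) (right c (+ (1 + m)) (+ r))))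
           (cong₂ ℤ._*_ (shifted 2 r (upper c (+ (1 + m)) (+ r))) refl) ⟨
    row (1 + r) (c ℤ.- 1ℤ) ℤ.* row (1 + r) (c ℤ.+ 1ℤ) ℤ.- row r c ℤ.* row (2 + r) c ∎
    where
    -- The smallest starting index among the five entries of the rule; the others exceed it by at
    -- most 2, so all five are entries of one chain.
    σ : ℤ
    σ = base c (2 + r)
    U : ℕ → Vec3
    U = unroll σ
    shifted : ∀ k r {i} → i ≡ + k ℤ.+ σ → entry (unroll i) 0 r ≡ entry U k r
    shifted k r i≡ = trans (cong (λ i → entry (unroll i) 0 r) i≡) (entry-unroll-+ k σ r)
    centre : ∀ c M r → c ℤ.+ M ℤ.- (1ℤ ℤ.+ r) ≡ 1ℤ ℤ.+ (c ℤ.+ M ℤ.- (+ 2 ℤ.+ r))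
    centre = ℤ-Solver.solve-∀
    left : ∀ c M r → c ℤ.- 1ℤ ℤ.+ M ℤ.- (1ℤ ℤ.+ r) ≡ 0ℤ ℤ.+ (c ℤ.+ M ℤ.- (+ 2 ℤ.+ r))
    left = ℤ-Solver.solve-∀
    right : ∀ c M r → c ℤ.+ 1ℤ ℤ.+ M ℤ.- (1ℤ ℤ.+ r) ≡ + 2 ℤ.+ (c ℤ.+ M ℤ.- (+ 2 ℤ.+ r))
    right = ℤ-Solver.solve-∀
    upper : ∀ c M r → c ℤ.+ M ℤ.- r ≡ + 2 ℤ.+ (c ℤ.+ M ℤ.- (+ 2 ℤ.+ r))
    upper = ℤ-Solver.solve-∀

  -- The period `K` is 2 N + 8, so the factors `U 0` and `U n` lie K - 3 apart. Replacing `U 0` by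
  -- `U K` makes them vectors three apart.
  row-bottom : ∀ c → row (1 + N) c ≡ 1ℤ
  row-bottom c = begin
    U 0 · U n              ≡⟨ ·-comm (U 0) (U n) ⟩
    U n · U 0              ≡⟨ cong (U n ·_) (unroll-period i 0) ⟨
    U n · U K              ≡⟨ cong (λ t → U n · U t) (K≡3+n m ℓ) ⟩
    U n · U (3 + n)        ≡⟨ ·≡1 (unroll-isChain i) n ⟩
    1ℤ                     ∎
    where
    i : ℤ
    i = base c (1 + N)
    U : ℕ → Vec3
    U = unroll i
    n : ℕ
    n = 3 + ((1 + N) + (1 + N))
    K≡3+n : ∀ m ℓ → 3 + ((1 + m) + (1 + m)) + (3 + ((1 + ℓ) + (1 + ℓ)))
      ≡ 6 + ((1 + (m + ℓ + 1)) + (1 + (m + ℓ + 1)))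
    K≡3+n = ℕ-Solver.solve-∀

  w-closed : IsClosed2Frieze N w
  w-closed = record
    { top       = λ c → entry-top (unroll-isChain (base c 0)) 0
    ; bottom    = λ c → trans (cong (λ r → row r c) (toℕ-fromℕ (1 + N))) (row-bottom c)
    ; localRule = rule
    }
    where
    rule : ∀ (i : Fin N) c → w (suc (inject₁ i)) c
      ≡ w (suc (inject₁ i)) (c ℤ.- 1ℤ) ℤ.* w (suc (inject₁ i)) (c ℤ.+ 1ℤ)
        ℤ.- w (inject₁ (inject₁ i)) c ℤ.* w (suc (suc i)) c
    rule i c rewrite toℕ-inject₁ (inject₁ i) | toℕ-inject₁ i = row-rule (toℕ i) c

  -- The hypothesis is `n` = t + `base (+ ε) r`, stated in ℕ without subtraction.
  unroll-base : ∀ n t {ε r} → n + r ≡ t + (ε + (1 + m)) → unroll (base (+ ε) r) t ≡ cycle n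
  unroll-base n t {ε} {r} n+r≡ = begin
    unroll i t             ≡⟨ cong (unroll i) (ℕ.+-identityʳ t) ⟨
    unroll i (t + 0)       ≡⟨ unroll-+ t i 0 ⟨
    unroll (+ t ℤ.+ i) 0   ≡⟨ cong (λ j → unroll j 0) t+i≡n ⟩
    cycle n                ∎
    where
    i : ℤ
    i = base (+ ε) r
    assoc : ∀ t ε M r → t ℤ.+ (ε ℤ.+ M ℤ.- r) ≡ t ℤ.+ (ε ℤ.+ M) ℤ.- r
    assoc = ℤ-Solver.solve-∀
    cancel : ∀ n r → n ℤ.+ r ℤ.- r ≡ n
    cancel = ℤ-Solver.solve-∀
    t+i≡n : + t ℤ.+ i ≡ + n
    t+i≡n = begin
      + t ℤ.+ i                               ≡⟨ assoc (+ t) (+ ε) (+ (1 + m)) (+ r) ⟩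
      + (t + (ε + (1 + m))) ℤ.- + r           ≡⟨ cong (λ k → + k ℤ.- + r) n+r≡ ⟨
      + n ℤ.+ + r ℤ.- + r                     ≡⟨ cancel (+ n) (+ r) ⟩
      + n                                     ∎

  cycle-left : ∀ {k} → k ≤ 1 + loopLength m → cycle k ≡ Loop.path A k
  cycle-left k≤ = trans
    (cycle-path (ℕ.≤-trans k≤ (s≤s (ℕ.m≤m+n (loopLength m) (loopLength ℓ)))))
    (concat-left A B k≤)

  cycle-right : ∀ {k} → k ≤ 1 + loopLength ℓ → cycle (loopLength m + k) ≡ Loop.path B k
  cycle-right {k} k≤ = trans
    (cycle-path (ℕ.≤-trans (ℕ.+-monoʳ-≤ (loopLength m) k≤)
      (ℕ.≤-reflexive (ℕ.+-suc (loopLength m) (loopLength ℓ)))))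
    (concat-right A B k)

  upper-columns : ∀ ε → ε ≤ 1 → (r : Fin (2 + m)) → row (toℕ r) (+ ε) ≡ a r (c ℤ.+ + ε)
  upper-columns ε ε≤1 r = begin
    row k (+ ε)
      ≡⟨ cong₂ _·_ (unroll-base s 0 (trans s+k≡ (ℕ.+-comm (1 + m) ε)))
                   (unroll-base (3 + (s + (k + k))) (3 + (k + k)) far) ⟩
    cycle s · cycle (3 + (s + (k + k)))
      ≡⟨ cong₂ _·_ (cycle-left (ℕ.≤-trans (ℕ.≤-trans (ℕ.m≤m+n s (k + k)) (ℕ.m≤n+m _ 3)) bound))
                   (cycle-left bound) ⟩
    entry (Loop.path A) s k
      ≡⟨ A-columns r s ε s+k≡ ⟩
    a r (c ℤ.+ + ε) ∎
    where
    k s : ℕ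
    k = toℕ r
    -- The index required by `FollowsColumns`; nothing is truncated since k ≤ 1 + m.
    s = (1 + m) + ε ∸ k
    k≤1+m : k ≤ 1 + m
    k≤1+m = ℕ.≤-pred (toℕ<n r)
    s+k≡ : s + k ≡ (1 + m) + ε
    s+k≡ = ℕ.m∸n+n≡m (ℕ.≤-trans k≤1+m (ℕ.m≤m+n (1 + m) ε))
    far : 3 + (s + (k + k)) + k ≡ 3 + (k + k) + (ε + (1 + m))
    far = trans (rearrange s k)
      (cong (λ t → 3 + (k + k) + t) (trans s+k≡ (ℕ.+-comm (1 + m) ε)))
      where
      rearrange : ∀ s k → 3 + (s + (k + k)) + k ≡ 3 + (k + k) + (s + k)
      rearrange = ℕ-Solver.solve-∀
    bound : 3 + (s + (k + k)) ≤ 1 + loopLength m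
    bound = entry-within-loop k≤1+m ε≤1 s+k≡

  -- The first factor has index ε - k. Moving it up by the period `K` puts it into the part of `B`,
  -- at or after the second factor. With the order of the factors reversed, row k appears as row ℓ +
  -- 1 - k of the loop, which is why `B` follows the flipped frieze.
  lower-columns : ∀ ε → ε ≤ 1 → (r : Fin (2 + ℓ)) → row ((1 + m) + toℕ r) (+ ε) ≡ b r (d ℤ.+ + ε)
  lower-columns ε ε≤1 r = begin
    U 0 · U (3 + (((1 + m) + k) + ((1 + m) + k)))
      ≡⟨ cong₂ _·_ (trans (sym (unroll-period (base (+ ε) ((1 + m) + k)) 0))
                          (unroll-base (loopLength m + (3 + (s + (q + q)))) K {ε} {(1 + m) + k} far))
                   (unroll-base (loopLength m + s) (3 + (((1 + m) + k) + ((1 + m) + k))) {ε} {(1 + m) + k}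
                     (near (1 + m) k ε)) ⟩
    cycle (loopLength m + (3 + (s + (q + q)))) · cycle (loopLength m + s)
      ≡⟨ cong₂ _·_ (cycle-right bound)
                   (cycle-right (ℕ.≤-trans (ℕ.≤-trans (ℕ.m≤m+n s (q + q)) (ℕ.m≤n+m _ 3)) bound)) ⟩
    Loop.path B (3 + (s + (q + q))) · Loop.path B s
      ≡⟨ ·-comm (Loop.path B (3 + (s + (q + q)))) (Loop.path B s) ⟩
    entry (Loop.path B) s q
      ≡⟨ B-columns (opposite r) s ε s+q≡ ⟩
    b (opposite (opposite r)) (d ℤ.+ + ε)
      ≡⟨ cong (λ r → b r (d ℤ.+ + ε)) (opposite-involutive r) ⟩
    b r (d ℤ.+ + ε) ∎
    where
    k q s : ℕ
    k = toℕ r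
    q = toℕ (opposite r)
    s = k + ε
    U : ℕ → Vec3
    U = unroll (base (+ ε) ((1 + m) + k))
    q+k≡ : q + k ≡ 1 + ℓ
    q+k≡ = trans (cong (λ t → t + k) (opposite-prop r)) (ℕ.m∸n+n≡m (ℕ.≤-pred (toℕ<n r)))
    s+q≡ : s + q ≡ (1 + ℓ) + ε
    s+q≡ = trans (lemma k ε q) (cong (λ t → t + ε) q+k≡)
      where
      lemma : ∀ k ε q → k + ε + q ≡ q + k + ε
      lemma = ℕ-Solver.solve-∀
    near : ∀ M k ε → 3 + (M + M) + (k + ε) + (M + k) ≡ 3 + ((M + k) + (M + k)) + (ε + M)
    near = ℕ-Solver.solve-∀
    far : loopLength m + (3 + (s + (q + q))) + ((1 + m) + k) ≡ K + (ε + (1 + m))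
    far = trans (lemma (loopLength m) (1 + m) k ε q)
                (cong (λ L → loopLength m + (3 + (L + L)) + (ε + (1 + m))) q+k≡)
      where
      lemma : ∀ T M k ε q → T + (3 + (k + ε + (q + q))) + (M + k)
        ≡ T + (3 + ((q + k) + (q + k))) + (ε + M)
      lemma = ℕ-Solver.solve-∀
    bound : 3 + (s + (q + q)) ≤ 1 + loopLength ℓ
    bound = entry-within-loop (ℕ.≤-pred (toℕ<n (opposite r))) ε≤1 s+q≡

  two-columns-positive : IsIntegralClosed2Frieze m a → IsIntegralClosed2Frieze ℓ b →
    ∀ ε → ε ≤ 1 → PositiveColumn w (+ ε)
  two-columns-positive Fa Fb ε ε≤1 s with ℕ.≤-<-connex (toℕ s) (1 + m)
  ... | inj₁ s≤1+m = subst (0ℤ ℤ.<_)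
    (trans (sym (upper-columns ε ε≤1 r)) (cong (λ k → row k (+ ε)) (toℕ-fromℕ< (s≤s s≤1+m))))
    (IsIntegralClosed2Frieze.positive Fa r _)
    where
    r : Fin (2 + m)
    r = fromℕ< (s≤s s≤1+m)
  ... | inj₂ 1+m<s = subst (0ℤ ℤ.<_)
    (trans (sym (lower-columns ε ε≤1 r))
           (cong (λ k → row k (+ ε))
             (trans (cong (λ t → (1 + m) + t) (toℕ-fromℕ< k<2+ℓ)) (ℕ.m+[n∸m]≡n (ℕ.<⇒≤ 1+m<s)))))
    (IsIntegralClosed2Frieze.positive Fb r _)
    where
    k<2+ℓ : toℕ s ∸ (1 + m) < 2 + ℓ
    k<2+ℓ = ℕ.+-cancelˡ-< (1 + m) _ _
      (subst₂ _<_ (sym (ℕ.m+[n∸m]≡n (ℕ.<⇒≤ 1+m<s))) (lemma m ℓ) (toℕ<n s))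
      where
      lemma : ∀ m ℓ → 2 + (m + ℓ + 1) ≡ (1 + m) + (2 + ℓ)
      lemma = ℕ-Solver.solve-∀
    r : Fin (2 + ℓ)
    r = fromℕ< k<2+ℓ

theorem2 : ∀ (m ℓ : ℕ) (a : Array m) (b : Array ℓ) →
    IsIntegralClosed2Frieze m a → IsIntegralClosed2Frieze ℓ b →
    ∀ (c d : ℤ) →
    Σ (Array (m + ℓ + 1)) λ w →
    IsIntegralClosed2Frieze (m + ℓ + 1) w
    × (∀ (ε : Fin 2) (r : Fin (2 + m)) (s : Fin (2 + (m + ℓ + 1))) →
    toℕ s ≡ toℕ r → w s (+ toℕ ε) ≡ a r (c ℤ.+ + toℕ ε))
    × (∀ (ε : Fin 2) (r : Fin (2 + ℓ)) (s : Fin (2 + (m + ℓ + 1))) →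
    toℕ s ≡ m + 1 + toℕ r → w s (+ toℕ ε) ≡ b r (d ℤ.+ + toℕ ε))
theorem2 m ℓ a b Fa Fb c d = w
  , record
    { isClosed2Frieze = w-closed
    ; positive        = λ r c → positive-from-two-columns w-closed
        (two-columns-positive Fa Fb 0 z≤n , two-columns-positive Fa Fb 1 (s≤s z≤n)) c r
    }
  , (λ ε r s s≡r → trans (cong (λ k → row k (+ toℕ ε)) s≡r)
      (upper-columns (toℕ ε) (ℕ.≤-pred (toℕ<n ε)) r))
  , (λ ε r s s≡r → trans
      (cong (λ k → row k (+ toℕ ε)) (trans s≡r (cong (λ t → t + toℕ r) (ℕ.+-comm m 1))))
      (lower-columns (toℕ ε) (ℕ.≤-pred (toℕ<n ε)) r))
  where
  loopA = frieze⇒loop Fa c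
  loopB = frieze⇒loop (flip-integral Fb) d
  open Glued {m} {ℓ} {a} {b} {c} {d} (proj₁ loopA) (proj₂ loopA) (proj₁ loopB) (proj₂ loopB)
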